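{- Let $\Gamma$ be a connected arc-transitive digraph that has Property Z, and let $G=\mathrm{Aut}(\Gamma)$. Let $\varphi:\Gamma\to\vec{\mathbb Z}$ be a surjective digraph homomorphism and $\Gamma_0=\varphi^{ -1}(0)$. Suppose that the in-valency and the out-valency of $\Gamma$ are both prime numbers. If the pointwise stabilizer $G_{(\Gamma_0)}$ is non-trivial, then $\Gamma$ is highly-arc-transitive.
   Context: A digraph $\Gamma=(V\Gamma,E\Gamma)$ has vertex set $V\Gamma$ and arc set $E\Gamma\subseteq V\Gamma\times V\Gamma$. It is connected if its underlying undirected graph is connected. For a vertex $v$, $\mathrm{in}(v)=\{u:(u,v)\in E\Gamma\}$ and $\mathrm{out}(v)=\{u:(v,u)\in E\Gamma\}$; their cardinalities are the in-valency and out-valency of $v$. Saying that $\Gamma$ has in-valency $q$ and out-valency $p$ means that every vertex has in-valency $q$ and out-valency $p$ (the two primes in the claim need not be equal). A digraph homomorphism is a map of vertex sets sending arcs to arcs (preserving direction). $\vec{\mathbb Z}$ is the digraph with vertex set $\mathbb Z$ and arcs $(i,i+1)$, $i\in\mathbb Z$. A connected digraph $\Gamma$ has Property Z if there is a surjective digraph homomorphism $\Gamma\to\vec{\mathbb Z}$ (such a homomorphism is unique up to adding an integer constant). A $k$-arc is a sequence of vertices $v_0,\dots,v_k$ with $(v_i,v_{i+1})\in E\Gamma$ for $0\le i<k$ (a 0-arc is a vertex). $\Gamma$ is arc-transitive if $\mathrm{Aut}(\Gamma)$ is transitive on arcs, $k$-arc-transitive if $\mathrm{Aut}(\Gamma)$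 is transitive on $k$-arcs, and highly-arc-transitive if it is $k$-arc-transitive for all $k$. For a set $A$ of vertices, $G_{(A)}=\{g\in G: a^g=a\text{ for all }a\in A\}$. -}

module Defs where

open import Data.Fin.Base using (Fin; suc; inject₁)
open import Data.Integer.Base using (ℤ; 1ℤ; _+_)
import Data.Integer.Properties as ℤ
open import Data.Nat.Base using (ℕ; suc)
open import Data.Product.Base using (∃; _×_)
open import Axiom.UniquenessOfIdentityProofs using (module Decidable⇒UIP)
open import Function.Bundles using (_↔_; _⇔_; Inverse)
open import Function.Definitions using (Surjective)
open import Level using (Level; _⊔_; 0ℓ) renaming (suc to lsuc)
open import Relation.Binary.Construct.Closure.Equivalence using (EqClosure)
open import Relation.Binary.Core using (Rel)
open import Relation.Binary.Definitions using (Irrelevant)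
open import Relation.Binary.PropositionalEquality.Core using (_≡_; _≢_)
open import Relation.Unary using (Pred)

private
  variable
    a b ℓ ℓ₁ ℓ₂ : Level

-- Irrelevance of E makes it a subset of V × V: no multiple arcs, so that
-- counting in- and out-neighbours below counts vertices.
record Digraph (a ℓ : Level) : Set (lsuc (a ⊔ ℓ)) where
  field
    V            : Set a
    E            : Rel V ℓ
    E-irrelevant : Irrelevant E

open Digraph public

in-nbrs : (Γ : Digraph a ℓ) → V Γ → Pred (V Γ) ℓ
in-nbrs Γ v u = E Γ u v

out-nbrs : (Γ : Digraph a ℓ) → V Γ → Pred (V Γ) ℓ
out-nbrs Γ v u = E Γ v u

HasInValency : Digraph a ℓ → ℕ → Set (a ⊔ ℓ)
HasInValency Γ q = ∀ v → ∃ (in-nbrs Γ v) ↔ Fin q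

HasOutValency : Digraph a ℓ → ℕ → Set (a ⊔ ℓ)
HasOutValency Γ p = ∀ v → ∃ (out-nbrs Γ v) ↔ Fin p

Connected : Digraph a ℓ → Set (a ⊔ ℓ)
Connected Γ = ∀ u v → EqClosure (E Γ) u v

record Hom (Γ : Digraph a ℓ₁) (Δ : Digraph b ℓ₂) : Set (a ⊔ b ⊔ ℓ₁ ⊔ ℓ₂) where
  field
    map     : V Γ → V Δ
    map-arc : ∀ {u v} → E Γ u v → E Δ (map u) (map v)

open Hom public

SurjectiveHom : {Γ : Digraph a ℓ₁} {Δ : Digraph b ℓ₂} → Hom Γ Δ → Set (a ⊔ b)
SurjectiveHom φ = Surjective _≡_ _≡_ (map φ)

ℤ⃗ : Digraph 0ℓ 0ℓ
ℤ⃗ = record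
  { V            = ℤ
  ; E            = λ i j → j ≡ i + 1ℤ
  ; E-irrelevant = Decidable⇒UIP.≡-irrelevant ℤ._≟_
  }

PropertyZ : Digraph a ℓ → Set (a ⊔ ℓ)
PropertyZ Γ = ∃ λ (φ : Hom Γ ℤ⃗) → SurjectiveHom φ

record Aut (Γ : Digraph a ℓ) : Set (a ⊔ ℓ) where
  field
    bijection : V Γ ↔ V Γ

  open Inverse bijection public using (to; from)

  field
    arc⇔ : ∀ {u v} → E Γ u v ⇔ E Γ (to u) (to v)

infixr 8 _·_

_·_ : {Γ : Digraph a ℓ} → Aut Γ → V Γ → V Γ
g · v = Aut.to g v

ArcTransitive : Digraph a ℓ → Set (a ⊔ ℓ)
ArcTransitive Γ = ∀ {u v u′ v′} → E Γ u v → E Γ u′ v′ →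
  ∃ λ (g : Aut Γ) → g · u ≡ u′ × g · v ≡ v′

record KArc (Γ : Digraph a ℓ) (k : ℕ) : Set (a ⊔ ℓ) where
  field
    vertex : Fin (suc k) → V Γ
    arc    : ∀ (i : Fin k) → E Γ (vertex (inject₁ i)) (vertex (suc i))

open KArc public

KArcTransitive : Digraph a ℓ → ℕ → Set (a ⊔ ℓ)
KArcTransitive Γ k = ∀ (x y : KArc Γ k) →
  ∃ λ (g : Aut Γ) → ∀ i → g · vertex x i ≡ vertex y i

HighlyArcTransitive : Digraph a ℓ → Set (a ⊔ ℓ)
HighlyArcTransitive Γ = ∀ k → KArcTransitive Γ k

PointwiseStabilizer : (Γ : Digraph a ℓ) → Pred (V Γ) ℓ₁ → Pred (Aut Γ) (a ⊔ ℓ₁)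
PointwiseStabilizer Γ A g = ∀ {v} → A v → g · v ≡ v

-- Automorphisms are compared by their action on vertices, so an element other
-- than the identity is one that moves some vertex; the moved vertex is given
-- explicitly rather than under a double negation.
NonTrivial : {Γ : Digraph a ℓ} → Pred (Aut Γ) ℓ₁ → Set (a ⊔ ℓ ⊔ ℓ₁)
NonTrivial {Γ = Γ} H = ∃ λ g → H g × ∃ λ (v : V Γ) → g · v ≢ v

Fibre : {Γ : Digraph a ℓ} → Hom Γ ℤ⃗ → ℤ → Pred (V Γ) 0ℓ
Fibre φ i v = map φ v ≡ i

{-# OPTIONS --safe #-}
-- Let g fix level 0 pointwise and move a vertex, below level 0 say (otherwise
-- reverse all arcs).  Cut off at level 0, g fixes all vertices of level ≥ 0, and
-- descending from there one meets a moved vertex w all of whose proper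
-- descendants are fixed.  Assume (k+1)-arc-transitivity and choose a walk
-- w → z₀ → … → z_{k+1}.  The automorphisms fixing z₀ and all out-neighbours of
-- z₀, …, z_k form a group K containing g and normalised by the stabilizer of
-- (z₀, …, z_k), which is transitive on the q in-neighbours of z₀.  Since q is
-- prime and K moves w, K is transitive on these in-neighbours too, which is
-- (k+2)-arc-transitivity.

module Submission where

open import Defs
open import Data.Fin.Base using (Fin; zero; suc; inject₁; opposite; combine; remQuot)
open import Data.Fin.Properties as Fin using (any?; all?)
open import Data.Integer.Base as ℤ using (ℤ; 0ℤ; 1ℤ; +_; -[1+_]; -_)
import Data.Integer.Properties as ℤ
open import Data.Integer.Tactic.RingSolver using (solve-∀)
open import Data.Nat.Base using (ℕ; zero; suc; NonZero; _+_; _*_; _≤_; _<_; z≤n; s≤s)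
open import Data.Nat.Divisibility using (_∣_; divides)
open import Data.Nat.Primality using (Prime; prime⇒irreducible; prime⇒nonZero)
import Data.Nat.Properties as ℕ
open import Data.Product.Base using (∃; ∃₂; _×_; _,_; proj₁; proj₂; uncurry)
open import Data.Sum.Base using (_⊎_; inj₁; inj₂; [_,_]′)
open import Data.Vec.Functional using (_∷_)
open import Function.Base using (_∘_; id)
open import Function.Bundles using (_↔_; Inverse; Equivalence; mk⇔; mk↔ₛ′)
open import Function.Definitions using (Injective)
open import Level using (Level)
open import Relation.Binary.Construct.Closure.Equivalence using (gfold)
open import Relation.Binary.Construct.Closure.ReflexiveTransitive using (Star; ε; _◅_; _◅◅_)
open import Relation.Binary.Core using (Rel)
open import Relation.Binary.Definitions using (Tri; tri<; tri≈; tri>)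
open import Relation.Binary.PropositionalEquality
open import Relation.Binary.Structures using (IsEquivalence)
open import Relation.Nullary using (Dec; yes; no; contradiction)
open import Relation.Nullary.Decidable using (map′)
open import Relation.Unary using (Pred)

private
  variable
    a ℓ ℓ₁ ℓ₂ : Level

-- Invariant equivalence relations on a set of prime size.

∷-injective : ∀ {n} {A : Set a} {x : A} {f : Fin n → A} →
  (∀ i → f i ≢ x) → Injective _≡_ _≡_ f → Injective _≡_ _≡_ (x ∷ f)
∷-injective x∉f f-inj {zero}  {zero}  _  = refl
∷-injective x∉f f-inj {zero}  {suc j} eq = contradiction (sym eq) (x∉f j)
∷-injective x∉f f-inj {suc i} {zero}  eq = contradiction eq (x∉f i)
∷-injective x∉f f-inj {suc i} {suc j} eq = cong suc (f-inj eq)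

-- `transport` stands in for a transitive group of permutations preserving `_~_`, whose classes are
-- then blocks of imprimitivity.
module Blocks
  {p} {_~_ : Rel (Fin p) ℓ} (equiv : IsEquivalence _~_)
  (transport : ∀ i j → ∃ λ (f : Fin p → Fin p) →
    Injective _≡_ _≡_ f × (∀ {k l} → k ~ l → f k ~ f l) × f i ≡ j)
  where

  module ~ = IsEquivalence equiv

  -- Possibly only a part of the class of `i`: a witness that this class has at least `m` points.
  record Block (m : ℕ) (i : Fin p) : Set ℓ where
    field
      elem      : Fin m → Fin p
      injective : Injective _≡_ _≡_ elem
      base      : ∃ λ k → elem k ≡ i
      related   : ∀ k → i ~ elem k

  open Block

  singleton : ∀ i → Block 1 i
  singleton i = record
    { elem      = λ _ → i
    ; injective = λ { {zero} {zero} _ → refl }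
    ; base      = zero , refl
    ; related   = λ _ → ~.refl
    }

  adjoin : ∀ {m i} (b : Block m i) {j} → i ~ j → (∀ k → elem b k ≢ j) → Block (suc m) i
  adjoin b {j} i~j j∉b = record
    { elem      = j ∷ elem b
    ; injective = ∷-injective j∉b (injective b)
    ; base      = suc (proj₁ (base b)) , proj₂ (base b)
    ; related   = λ { zero → i~j ; (suc k) → related b k }
    }

  -- Enlarging one block is as good as enlarging all of them, since the larger block can be carried
  -- to every point.
  move : ∀ {m i} → Block m i → ∀ j → Block m j
  move {i = i} b j with f , f-inj , f-~ , fi≡j ← transport i j = record
    { elem      = f ∘ elem b
    ; injective = injective b ∘ f-inj
    ; base      = proj₁ (base b) , trans (cong f (proj₂ (base b))) fi≡j
    ; related   = λ k → subst (_~ f (elem b k)) fi≡j (f-~ (related b k))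
    }

  module _ {m} (blocks : ∀ i → Block m i) where

    record Tiling (r : ℕ) : Set where
      field
        rep      : Fin r → Fin p
        disjoint : ∀ {s t k l} →
          elem (blocks (rep s)) k ≡ elem (blocks (rep t)) l → s ≡ t

      tile : Fin r → Fin m → Fin p
      tile s = elem (blocks (rep s))

      cell : Fin (r * m) → Fin p
      cell = uncurry tile ∘ remQuot {r} m

      cell-injective : Injective _≡_ _≡_ cell
      cell-injective {x} {y} eq = begin
        x                              ≡⟨ Fin.combine-remQuot {r} m x ⟨
        uncurry combine (remQuot {r} m x)  ≡⟨ cong (uncurry combine) (tile-injective eq) ⟩
        uncurry combine (remQuot {r} m y)  ≡⟨ Fin.combine-remQuot {r} m y ⟩
        y                              ∎
        where
        open ≡-Reasoning
        tile-injective : Injective _≡_ _≡_ (uncurry tile)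
        tile-injective {s , k} {t , l} eq with refl ← disjoint {s} {t} eq =
          cong (s ,_) (injective (blocks (rep s)) eq)

      size≤ : r * m ≤ p
      size≤ = Fin.injective⇒≤ cell-injective

      -- Equality `p = r * m` by two injections: `cell` always gives `r * m ≤ p`, and choosing a
      -- position for each covered point gives the converse.
      covering⇒∣ : (∀ i → ∃₂ λ s k → tile s k ≡ i) → m ∣ p
      covering⇒∣ cover = divides r (ℕ.≤-antisym (Fin.injective⇒≤ position-injective) size≤)
        where
        position : Fin p → Fin (r * m)
        position i = let s , k , _ = cover i in combine s k

        cell-position : ∀ i → cell (position i) ≡ i
        cell-position i = let s , k , eq = cover i in
          trans (cong (uncurry tile) (Fin.remQuot-combine s k)) eq

        position-injective : Injective _≡_ _≡_ position
        position-injective {i} {j} eq =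
          trans (sym (cell-position i)) (trans (cong cell eq) (cell-position j))

    open Tiling

    addTile : ∀ {r} (T : Tiling r) {i} →
      (∀ s k l → tile T s k ≢ elem (blocks i) l) → Tiling (suc r)
    addTile {r} T {i} apart = record { rep = rep′ ; disjoint = λ {s} {t} → disjoint′ s t }
      where
      rep′ : Fin (suc r) → Fin p
      rep′ zero    = i
      rep′ (suc s) = rep T s

      disjoint′ : ∀ s t {k l} →
        elem (blocks (rep′ s)) k ≡ elem (blocks (rep′ t)) l → s ≡ t
      disjoint′ zero    zero    _  = refl
      disjoint′ zero    (suc t) eq = contradiction (sym eq) (apart t _ _)
      disjoint′ (suc s) zero    eq = contradiction eq (apart s _ _)
      disjoint′ (suc s) (suc t) eq = cong suc (disjoint T eq)

    -- Orbits of _~_ cannot be counted, as _~_ is not decidable; instead, blocks of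
    -- a common size m either tile all p points or one of them can be enlarged:
    -- if the block of an uncovered point meets a tile, then the
    -- representative of that tile is related to this point, which is adjoined.
    divides⊎enlarge : ∀ n r → p < n + r → Tiling r → m ∣ p ⊎ ∃ (Block (suc m))
    divides⊎enlarge n r p<n+r T
      with all? (λ i → any? λ s → any? λ k → tile T s k Fin.≟ i)
    ... | yes cover = inj₁ (covering⇒∣ T cover)
    ... | no ¬cover
      with i , i∉T ← Fin.¬∀⟶∃¬ p _ (λ i → any? λ s → any? λ k → tile T s k Fin.≟ i) ¬cover
      with any? (λ s → any? λ k → any? λ l → tile T s k Fin.≟ elem (blocks i) l)
    ... | yes (s , k , l , eq) =
      inj₂ (rep T s , adjoin (blocks (rep T s)) s~i λ k eq → i∉T (s , k , eq))
      where
      s~i : rep T s ~ i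
      s~i = ~.trans (related (blocks (rep T s)) k)
                    (subst (_~ i) (sym eq) (~.sym (related (blocks i) l)))
    ... | no apart with n
    ...   | suc n = divides⊎enlarge n (suc r) (subst (p <_) (sym (ℕ.+-suc n r)) p<n+r)
                      (addTile T λ s k l eq → apart (s , k , l , eq))
    -- Here `p < r`, although `r` disjoint non-empty tiles occupy at least `r` of the `p` points.
    ...   | zero  = contradiction (ℕ.≤-trans (ℕ.m≤m*n r m) (size≤ T)) (ℕ.<⇒≱ p<n+r)
      where instance _ = Fin.nonZeroIndex (proj₁ (base (blocks i)))

  module _ (p-prime : Prime p) where

    -- Blocks are enlarged until their size `m` divides `p`. Since `2 ≤ m`, primality forces
    -- `m = p`, and a block of `p` distinct points contains `j`. Each enlargement trades one unit of
    -- `n` for one of `m`; at `n = 0` a further one is impossible because blocks already have more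
    -- than `p` points.
    related-from-blocks : ∀ n m → p < n + m → 2 ≤ m → (∀ i → Block m i) → ∀ i j → i ~ j
    related-from-blocks n m p<n+m 2≤m blocks i j
      with divides⊎enlarge blocks (suc p) 0 (s≤s (ℕ.m≤m+n p 0))
             (record { rep = λ () ; disjoint = λ { {()} } })
    ... | inj₂ (o , b) with n
    ...   | suc n = related-from-blocks n (suc m) (subst (p <_) (sym (ℕ.+-suc n m)) p<n+m)
                      (ℕ.m≤n⇒m≤1+n 2≤m) (move b) i j
    ...   | zero  = contradiction (Fin.injective⇒≤ (injective (blocks i))) (ℕ.<⇒≱ p<n+m)
    related-from-blocks n m p<n+m 2≤m blocks i j
      | inj₁ m∣p with prime⇒irreducible p-prime m∣p
    ... | inj₁ refl = contradiction 2≤m λ { (s≤s ()) }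
    ... | inj₂ refl with any? (λ k → elem (blocks i) k Fin.≟ j)
    ...   | yes (k , refl) = related (blocks i) k
    ...   | no j∉b = contradiction
      (Fin.injective⇒≤ (∷-injective (λ k eq → j∉b (k , eq)) (injective (blocks i)))) ℕ.1+n≰n

    -- A form of the fact that a transitive group of prime degree is primitive. The given pair is a
    -- block of size 2, which starts the enlargement.
    prime⇒related : ∀ {k l} → k ≢ l → k ~ l → ∀ i j → i ~ j
    prime⇒related {k} {l} k≢l k~l = related-from-blocks p 2 (ℕ.m<m+n p (s≤s z≤n)) ℕ.≤-refl
      (move (adjoin (singleton k) k~l λ _ → k≢l))

-- Finite neighbourhoods enumerated by indices.

module Enumeration {A : Set a} {P : Pred A ℓ} (irrelevant : ∀ {x} (px qx : P x) → px ≡ qx)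
  {n} (enum : ∃ P ↔ Fin n) where

  open Inverse enum

  element : Fin n → A
  element i = proj₁ (from i)

  element∈ : ∀ i → P (element i)
  element∈ i = proj₂ (from i)

  index : ∀ {x} → P x → Fin n
  index px = to (_ , px)

  element-index : ∀ {x} (px : P x) → element (index px) ≡ x
  element-index px = cong proj₁ (strictlyInverseʳ (_ , px))

  index-injective : ∀ {x y} {px : P x} {py : P y} → index px ≡ index py → x ≡ y
  index-injective {px = px} {py} eq =
    trans (sym (element-index px)) (trans (cong element eq) (element-index py))

  -- Irrelevance enters here: otherwise two indices could stand for two proofs about the same
  -- vertex.
  element-injective : Injective _≡_ _≡_ element
  element-injective {i} {j} eq =
    trans (sym (strictlyInverseˡ i)) (trans (index-cong eq) (strictlyInverseˡ j))
    where
    index-cong : ∀ {x y} {px : P x} {py : P y} → x ≡ y → index px ≡ index py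
    index-cong {px = px} {py} refl = cong index (irrelevant px py)

  ≡-dec : ∀ {x y} → P x → P y → Dec (x ≡ y)
  ≡-dec px py = map′ index-injective
    (λ { refl → cong index (irrelevant px py) }) (index px Fin.≟ index py)

-- Automorphisms and the orbits of normalised stabilizers.

module Automorphisms (Γ : Digraph a ℓ) where

  private
    _⟶_ = E Γ

  mkAut : (f f⁻¹ : V Γ → V Γ) → (∀ v → f (f⁻¹ v) ≡ v) → (∀ v → f⁻¹ (f v) ≡ v) →
    (∀ {u v} → u ⟶ v → f u ⟶ f v) → (∀ {u v} → u ⟶ v → f⁻¹ u ⟶ f⁻¹ v) → Aut Γ
  mkAut f f⁻¹ invˡ invʳ f-arc f⁻¹-arc = record
    { bijection = mk↔ₛ′ f f⁻¹ invˡ invʳ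
    ; arc⇔      = mk⇔ f-arc λ e → subst₂ _⟶_ (invʳ _) (invʳ _) (f⁻¹-arc e)
    }

  module _ (g : Aut Γ) where

    ·-from : ∀ v → g · Aut.from g v ≡ v
    ·-from = Inverse.strictlyInverseˡ (Aut.bijection g)

    from-· : ∀ v → Aut.from g (g · v) ≡ v
    from-· = Inverse.strictlyInverseʳ (Aut.bijection g)

    ·-arc : ∀ {u v} → u ⟶ v → (g · u) ⟶ (g · v)
    ·-arc = Equivalence.to (Aut.arc⇔ g)

    from-arc : ∀ {u v} → u ⟶ v → Aut.from g u ⟶ Aut.from g v
    from-arc e = Equivalence.from (Aut.arc⇔ g)
      (subst₂ _⟶_ (sym (·-from _)) (sym (·-from _)) e)

    ·-injective : ∀ {u v} → g · u ≡ g · v → u ≡ v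
    ·-injective eq = trans (sym (from-· _)) (trans (cong (Aut.from g) eq) (from-· _))

    from-fixed : ∀ {v} → g · v ≡ v → Aut.from g v ≡ v
    from-fixed eq = trans (cong (Aut.from g) (sym eq)) (from-· _)

  idᴬ : Aut Γ
  idᴬ = mkAut id id (λ _ → refl) (λ _ → refl) id id

  infix 10 _⁻¹
  _⁻¹ : Aut Γ → Aut Γ
  g ⁻¹ = mkAut (Aut.from g) (Aut.to g) (from-· g) (·-from g) (from-arc g) (·-arc g)

  infixr 9 _∙_
  _∙_ : Aut Γ → Aut Γ → Aut Γ
  g ∙ h = mkAut (Aut.to g ∘ Aut.to h) (Aut.from h ∘ Aut.from g)
    (λ v → trans (cong (g ·_) (·-from h _)) (·-from g v))
    (λ v → trans (cong (Aut.from h) (from-· g _)) (from-· h v))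
    (·-arc g ∘ ·-arc h) (from-arc h ∘ from-arc g)

  conjugate-fixes : ∀ b {A : Pred (V Γ) ℓ₁} → (∀ {v} → A v → A (Aut.from b v)) →
    ∀ {g} → PointwiseStabilizer Γ A g → PointwiseStabilizer Γ A (b ∙ g ∙ b ⁻¹)
  conjugate-fixes b b⁻¹A⊆A fix v∈A = trans (cong (b ·_) (fix (b⁻¹A⊆A v∈A))) (·-from b _)

  module _ {q} (inVal : HasInValency Γ q) (q-prime : Prime q) where

    -- The stabilizer of A is normalised by the elements b below, so its orbits
    -- on the q in-neighbours of v are permuted transitively.
    stabilizer-transitive-on-in : ∀ {A : Pred (V Γ) ℓ₁} {v} → A v →
      (∀ {u u′} → u ⟶ v → u′ ⟶ v → ∃ λ b →
        b · v ≡ v × b · u ≡ u′ × (∀ {x} → A x → A (Aut.from b x))) →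
      ∀ {g w} → PointwiseStabilizer Γ A g → w ⟶ v → g · w ≢ w →
      ∀ {u u′} → u ⟶ v → u′ ⟶ v →
      ∃ λ h → PointwiseStabilizer Γ A h × h · u ≡ u′
    stabilizer-transitive-on-in {A = A} {v} v∈A normal {g} {w} g-fix w⟶v gw≢w u⟶v u′⟶v =
      -- As `g` fixes `v`, the vertex `g · w` is again an in-neighbour of `v`; with `w` it forms the
      -- pair of distinct related points required.
      let h , h-fix , eq = Blocks.prime⇒related equiv transport q-prime {index gw⟶v} {index w⟶v}
            (λ eq → gw≢w (index-injective eq))
            (g ⁻¹ , from-fixed g ∘ g-fix , moves) (index u⟶v) (index u′⟶v)
      in h , h-fix , subst₂ (λ x y → h · x ≡ y) (element-index u⟶v) (element-index u′⟶v) eq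
      where
      open Enumeration (λ {x} → E-irrelevant Γ {x} {v}) (inVal v)

      _~_ : Fin q → Fin q → Set _
      i ~ j = ∃ λ h → PointwiseStabilizer Γ A h × h · element i ≡ element j

      gw⟶v : (g · w) ⟶ v
      gw⟶v = subst (_ ⟶_) (g-fix v∈A) (·-arc g w⟶v)

      moves : g ⁻¹ · element (index gw⟶v) ≡ element (index w⟶v)
      moves = trans (cong (Aut.from g) (element-index gw⟶v))
                    (trans (from-· g w) (sym (element-index w⟶v)))

      equiv : IsEquivalence _~_
      equiv = record
        { refl  = idᴬ , (λ _ → refl) , refl
        ; sym   = λ { (h , fix , eq) →
            h ⁻¹ , from-fixed h ∘ fix , trans (cong (Aut.from h) (sym eq)) (from-· h _) }
        ; trans = λ { (h , fix , eq) (h′ , fix′ , eq′) →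
            h′ ∙ h , (λ x∈A → trans (cong (h′ ·_) (fix x∈A)) (fix′ x∈A)) ,
            trans (cong (h′ ·_) eq) eq′ }
        }

      transport : ∀ i j → ∃ λ (f : Fin q → Fin q) →
        Injective _≡_ _≡_ f × (∀ {k l} → k ~ l → f k ~ f l) × f i ≡ j
      transport i j with b , bv≡v , bi≡j , b⁻¹A⊆A ← normal (element∈ i) (element∈ j) =
        f , element-injective ∘ ·-injective b ∘ index-injective , f-~ ,
        element-injective (trans (element-f i) bi≡j)
        where
        b-arc : ∀ k → (b · element k) ⟶ v
        b-arc k = subst ((b · element k) ⟶_) bv≡v (·-arc b (element∈ k))

        f : Fin q → Fin q
        f k = index (b-arc k)

        element-f : ∀ k → element (f k) ≡ b · element k
        element-f k = element-index (b-arc k)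

        f-~ : ∀ {k l} → k ~ l → f k ~ f l
        f-~ {k} {l} (h , fix , eq) = b ∙ h ∙ b ⁻¹ , conjugate-fixes b b⁻¹A⊆A {h} fix , (begin
          b · h · Aut.from b (element (f k))    ≡⟨ cong (λ x → b · h · Aut.from b x) (element-f k) ⟩
          b · h · Aut.from b (b · element k)    ≡⟨ cong (λ x → b · h · x) (from-· b _) ⟩
          b · h · element k                     ≡⟨ cong (b ·_) eq ⟩
          b · element l                         ≡⟨ element-f l ⟨
          element (f l)                         ∎)
          where open ≡-Reasoning

-- Search for a first moved vertex.

finite-choice : ∀ {n} {P : Pred (Fin n) ℓ₁} {B : Set ℓ₂} →
  (∀ i → P i ⊎ B) → (∀ i → P i) ⊎ B
finite-choice {n = zero}  f = inj₁ λ ()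
finite-choice {n = suc n} f with f zero | finite-choice (f ∘ suc)
... | inj₂ b | _      = inj₂ b
... | inj₁ _ | inj₂ b = inj₂ b
... | inj₁ p | inj₁ h = inj₁ λ { zero → p ; (suc i) → h i }

module FirstMovedVertices (Γ : Digraph a ℓ) where

  open Automorphisms Γ

  private
    _⟶_ = E Γ

  FixedFrom : Aut Γ → Pred (V Γ) _
  FixedFrom g v = ∀ u → Star _⟶_ v u → g · u ≡ u

  FirstMoved : Aut Γ → Pred (V Γ) _
  FirstMoved g w = g · w ≢ w × (∀ {u} → w ⟶ u → FixedFrom g u)

  module _ {q p} (inVal : HasInValency Γ q) (outVal : HasOutValency Γ p)
    (next : ∀ v → ∃ (out-nbrs Γ v)) where

    -- Equality of vertices need not be decidable, but w and g · w can be
    -- compared once g fixes an out-neighbour of w.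
    all-successors-fixed : ∀ g {w} → (∀ {u} → w ⟶ u → FixedFrom g u) →
      FixedFrom g w ⊎ ∃ (FirstMoved g)
    all-successors-fixed g {w} fixed with next w
    ... | z , w⟶z with ≡-dec (subst ((g · w) ⟶_) (fixed w⟶z z ε) (·-arc g w⟶z)) w⟶z
      where open Enumeration (λ {x} → E-irrelevant Γ {x} {z}) (inVal z)
    ...   | yes gw≡w = inj₁ λ { _ ε → gw≡w ; u (e ◅ es) → fixed e u es }
    ...   | no  gw≢w = inj₂ (w , gw≢w , fixed)

    -- The finitely many out-neighbours of `w` are inspected in turn: either one of them supplies a
    -- first moved vertex, or all are fixed with their descendants and `w` itself is tested.
    fixed-or-first-moved : ∀ g {w} →
      (∀ {u} → w ⟶ u → FixedFrom g u ⊎ ∃ (FirstMoved g)) → FixedFrom g w ⊎ ∃ (FirstMoved g)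
    fixed-or-first-moved g {w} alternatives =
      [ (λ fixed → all-successors-fixed g λ e →
          subst (FixedFrom g) (element-index e) (fixed (index e)))
      , inj₂
      ]′ (finite-choice (alternatives ∘ element∈))
      where open Enumeration (λ {x} → E-irrelevant Γ {w} {x}) (outVal w)

-- Induction on the length of arcs.

module Arcs (Γ : Digraph a ℓ) where

  open Automorphisms Γ
  open FirstMovedVertices Γ

  private
    _⟶_ = E Γ

  cons : ∀ {u k} (x : KArc Γ k) → u ⟶ vertex x zero → KArc Γ (suc k)
  cons {u} {k} x e = record { vertex = vertex′ ; arc = λ { zero → e ; (suc i) → arc x i } }
    where
    vertex′ : Fin (suc (suc k)) → V Γ
    vertex′ zero    = u
    vertex′ (suc i) = vertex x i

  tail : ∀ {k} → KArc Γ (suc k) → KArc Γ k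
  tail x = record { vertex = vertex x ∘ suc ; arc = arc x ∘ suc }

  init : ∀ {k} → KArc Γ (suc k) → KArc Γ k
  init x = record { vertex = vertex x ∘ inject₁ ; arc = arc x ∘ inject₁ }

  module _ (next : ∀ v → ∃ (out-nbrs Γ v)) where

    walk : ∀ k → V Γ → Fin (suc k) → V Γ
    walk k       v zero    = v
    walk (suc k) v (suc i) = walk k (proj₁ (next v)) i

    walk-arc : ∀ k v i → walk k v (inject₁ i) ⟶ walk k v (suc i)
    walk-arc (suc k) v zero    = proj₂ (next v)
    walk-arc (suc k) v (suc i) = walk-arc k (proj₁ (next v)) i

    walk-reachable : ∀ k v i → Star _⟶_ v (walk k v i)
    walk-reachable k       v zero    = ε
    walk-reachable (suc k) v (suc i) = proj₂ (next v) ◅ walk-reachable k _ i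

    walkArc : ∀ k → V Γ → KArc Γ k
    walkArc k v = record { vertex = walk k v ; arc = walk-arc k v }

  -- Automorphisms carry `tail x` and `tail y` to `z`, and the two heads to in-neighbours of its
  -- first vertex. The stabilizer of `A` fixes every vertex of `z` and matches these heads.
  prolong : ∀ {q} → HasInValency Γ q → Prime q → ∀ {k} → KArcTransitive Γ (suc k) →
    (z : KArc Γ (suc k)) → ∀ {g w} → w ⟶ vertex z zero → g · w ≢ w →
    g · vertex z zero ≡ vertex z zero →
    (∀ i {u} → vertex z (inject₁ i) ⟶ u → g · u ≡ u) →
    KArcTransitive Γ (suc (suc k))
  prolong inVal q-prime {k} trans-k z {g} {w} w⟶z₀ gw≢w g-fix-z₀ g-fix-out x y =
    connect (trans-k (tail x) z) (trans-k (tail y) z)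
    where
    -- The out-neighbours taken include every vertex of `z` but the first, which is therefore added.
    -- Those of the last vertex are left out so that `normal` can hold.
    A : V Γ → Set _
    A u = u ≡ vertex z zero ⊎ ∃ λ i → vertex z (inject₁ i) ⟶ u

    g-fix : PointwiseStabilizer Γ A g
    g-fix (inj₁ refl)    = g-fix-z₀
    g-fix (inj₂ (i , e)) = g-fix-out i e

    h-fix-z : ∀ {h} → PointwiseStabilizer Γ A h → ∀ i → h · vertex z i ≡ vertex z i
    h-fix-z fix zero    = fix (inj₁ refl)
    h-fix-z fix (suc i) = fix (inj₂ (i , arc z i))

    through : ∀ {b} → (∀ i → b · vertex x (suc i) ≡ vertex z i) →
      ∀ {c} → (∀ i → c · vertex y (suc i) ≡ vertex z i) →
      (∃ λ h → PointwiseStabilizer Γ A h × h · b · vertex x zero ≡ c · vertex y zero) →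
      ∃ λ g → ∀ i → g · vertex x i ≡ vertex y i
    through {b} bx≡z {c} cy≡z (h , h-fix , hbx₀≡cy₀) = c ⁻¹ ∙ h ∙ b , λ where
      zero    → trans (cong (Aut.from c) hbx₀≡cy₀) (from-· c _)
      (suc i) → trans (cong (λ v → Aut.from c (h · v)) (bx≡z i))
        (trans (cong (Aut.from c) (trans (h-fix-z {h} h-fix i) (sym (cy≡z i)))) (from-· c _))

    -- Dropping the last vertex of `z` makes room for a new first one without exceeding length
    -- `suc k`. The resulting `b` fixes `init z` vertexwise, so its inverse permutes the
    -- out-neighbours of these vertices and preserves `A`.
    normal : ∀ {u u′} → u ⟶ vertex z zero → u′ ⟶ vertex z zero → ∃ λ b →
      b · vertex z zero ≡ vertex z zero × b · u ≡ u′ × (∀ {x} → A x → A (Aut.from b x))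
    normal e e′ =
      let b , b-eq = trans-k (cons (init z) e) (cons (init z) e′)
      in b , b-eq (suc zero) , b-eq zero , λ where
        (inj₁ refl)        → inj₁ (from-fixed b (b-eq (suc zero)))
        {x} (inj₂ (i , e)) → inj₂ (i , subst (_⟶ Aut.from b x) (from-fixed b (b-eq (suc i))) (from-arc b e))

    connect : (∃ λ b → ∀ i → b · vertex (tail x) i ≡ vertex z i) →
      (∃ λ c → ∀ i → c · vertex (tail y) i ≡ vertex z i) →
      ∃ λ g → ∀ i → g · vertex x i ≡ vertex y i
    connect (b , bx≡z) (c , cy≡z) = through {b} bx≡z {c} cy≡z
      (stabilizer-transitive-on-in inVal q-prime {A = A} (inj₁ refl) normal {g} g-fix w⟶z₀ gw≢w
        (subst ((b · vertex x zero) ⟶_) (bx≡z zero) (·-arc b (arc x zero)))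
        (subst ((c · vertex y zero) ⟶_) (cy≡z zero) (·-arc c (arc y zero))))

  highlyArcTransitive : ∀ {q} → ArcTransitive Γ → HasInValency Γ q → Prime q →
    (∀ v → ∃ (out-nbrs Γ v)) → ∀ {g w} → FirstMoved g w → HighlyArcTransitive Γ
  highlyArcTransitive arcTrans inVal q-prime next moved zero x y
    with g , g-eq , _ ← arcTrans (proj₂ (next (vertex x zero))) (proj₂ (next (vertex y zero)))
    = g , λ { zero → g-eq }
  highlyArcTransitive arcTrans inVal q-prime next moved (suc zero) x y
    with g , eq₀ , eq₁ ← arcTrans (arc x zero) (arc y zero)
    = g , λ { zero → eq₀ ; (suc zero) → eq₁ }
  highlyArcTransitive arcTrans inVal q-prime next {g} {w} moved@(gw≢w , fix) (suc (suc k)) =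
    prolong inVal q-prime
      (highlyArcTransitive arcTrans inVal q-prime next {g} moved (suc k))
      (walkArc next (suc k) (proj₁ (next w))) {g} w⟶z₀ gw≢w (fix w⟶z₀ _ ε)
      -- Every out-neighbour of a vertex of the walk is a proper descendant of `w`.
      (λ i e → fix w⟶z₀ _ (walk-reachable next (suc k) _ (inject₁ i) ◅◅ (e ◅ ε)))
    where
    w⟶z₀ = proj₂ (next w)

-- Levels, and cutting an automorphism off at level 0.

module Levels {Γ : Digraph a ℓ} (φ : Hom Γ ℤ⃗) where

  open Automorphisms Γ
  open FirstMovedVertices Γ

  private
    _⟶_ = E Γ
    level = map φ

  -- The change of level under `g` is the same at both ends of an arc, hence constant by
  -- connectedness, and it vanishes at `o`.
  Aut-preserves-level : Connected Γ → ∀ {o} (g : Aut Γ) → g · o ≡ o →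
    ∀ v → level (g · v) ≡ level v
  Aut-preserves-level connected {o} g go≡o v = ℤ.i-j≡0⇒i≡j _ _ (begin
    level (g · v) ℤ.- level v  ≡⟨ gfold isEquivalence shift shift-arc (connected v o) ⟩
    level (g · o) ℤ.- level o  ≡⟨ ℤ.i≡j⇒i-j≡0 (cong level go≡o) ⟩
    0ℤ                         ∎)
    where
    open ≡-Reasoning
    cancel : ∀ i j → (i ℤ.+ 1ℤ) ℤ.- (j ℤ.+ 1ℤ) ≡ i ℤ.- j
    cancel = solve-∀

    shift : V Γ → ℤ
    shift v = level (g · v) ℤ.- level v

    shift-arc : ∀ {u v} → u ⟶ v → shift u ≡ shift v
    shift-arc {u} {v} e = sym (begin
      level (g · v) ℤ.- level v                  ≡⟨ cong₂ ℤ._-_ (map-arc φ (·-arc g e)) (map-arc φ e) ⟩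
      (level (g · u) ℤ.+ 1ℤ) ℤ.- (level u ℤ.+ 1ℤ)  ≡⟨ cancel (level (g · u)) (level u) ⟩
      level (g · u) ℤ.- level u                  ∎)

  reachable⇒≤ : ∀ {u v} → Star _⟶_ u v → level u ℤ.≤ level v
  reachable⇒≤ ε        = ℤ.≤-refl
  reachable⇒≤ (e ◅ es) = ℤ.≤-trans (subst (level _ ℤ.≤_) (sym (map-arc φ e)) (ℤ.i≤i+j _ 1ℤ))
                                   (reachable⇒≤ es)

  -- Induction on `n`, a bound for the depth of `w` below level 0; each arc climbs one level. At
  -- `n = 0` all descendants of `w` have non-negative level.
  first-moved : ∀ {q p} → HasInValency Γ q → HasOutValency Γ p → (∀ v → ∃ (out-nbrs Γ v)) →
    (g : Aut Γ) → (∀ {v} → 0ℤ ℤ.≤ level v → g · v ≡ v) →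
    ∀ n w → 0ℤ ℤ.≤ + n ℤ.+ level w → FixedFrom g w ⊎ ∃ (FirstMoved g)
  first-moved inVal outVal next g fix zero    w 0≤w   = inj₁ λ _ es →
    fix (ℤ.≤-trans (subst (0ℤ ℤ.≤_) (ℤ.+-identityˡ (level w)) 0≤w) (reachable⇒≤ es))
  first-moved inVal outVal next g fix (suc n) w 0≤n+w =
    fixed-or-first-moved inVal outVal next g λ {u} e →
      first-moved inVal outVal next g fix n u (subst (0ℤ ℤ.≤_) (level-step e) 0≤n+w)
    where
    shuffle : ∀ i j → (1ℤ ℤ.+ i) ℤ.+ j ≡ i ℤ.+ (j ℤ.+ 1ℤ)
    shuffle = solve-∀

    level-step : ∀ {u} → w ⟶ u → + suc n ℤ.+ level w ≡ + n ℤ.+ level u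
    level-step e = trans (shuffle (+ n) (level w)) (cong (λ i → + n ℤ.+ i) (sym (map-arc φ e)))

  module _ (f : V Γ → V Γ) where

    onNegative : V Γ → V Γ
    onNegative v with level v ℤ.<? 0ℤ
    ... | yes _ = f v
    ... | no  _ = v

    onNegative-neg : ∀ {v} → level v ℤ.< 0ℤ → onNegative v ≡ f v
    onNegative-neg {v} v<0 with level v ℤ.<? 0ℤ
    ... | yes _   = refl
    ... | no  v≮0 = contradiction v<0 v≮0

    onNegative-nonneg : ∀ {v} → 0ℤ ℤ.≤ level v → onNegative v ≡ v
    onNegative-nonneg {v} 0≤v with level v ℤ.<? 0ℤ
    ... | yes v<0 = contradiction v<0 (ℤ.≤⇒≯ 0≤v)
    ... | no  _   = refl

    onNegative-arc : (∀ {u v} → u ⟶ v → f u ⟶ f v) → (∀ {v} → level v ≡ 0ℤ → f v ≡ v) →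
      ∀ {u v} → u ⟶ v → onNegative u ⟶ onNegative v
    onNegative-arc f-arc f-fix {u} {v} e with level u ℤ.<? 0ℤ | level v ℤ.<? 0ℤ
    ... | yes _   | yes _   = f-arc e
    ... | no  _   | no  _   = e
    ... | no  u≮0 | yes v<0 =
      contradiction (ℤ.≤-<-trans (reachable⇒≤ (e ◅ ε)) v<0) u≮0
    ... | yes u<0 | no  v≮0 =
      subst (f u ⟶_) (f-fix (ℤ.≤-antisym v≤0 (ℤ.≮⇒≥ v≮0))) (f-arc e)
      where
      v≤0 : level v ℤ.≤ 0ℤ
      v≤0 = subst (ℤ._≤ 0ℤ) (trans (ℤ.+-comm 1ℤ (level u)) (sym (map-arc φ e)))
                  (ℤ.i<j⇒suc[i]≤j u<0)

  -- Preservation of levels keeps `f′ v` on the same side of the cut as `v`, so both maps take the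
  -- same branch.
  onNegative-inverse : ∀ {f f′ : V Γ → V Γ} → (∀ v → f (f′ v) ≡ v) →
    (∀ v → level (f′ v) ≡ level v) → ∀ v → onNegative f (onNegative f′ v) ≡ v
  onNegative-inverse {f} {f′} inverse f′-level v with level v ℤ.<? 0ℤ
  ... | yes v<0 = trans (onNegative-neg f (subst (ℤ._< 0ℤ) (sym (f′-level v)) v<0)) (inverse v)
  ... | no  v≮0 = onNegative-nonneg f (ℤ.≮⇒≥ v≮0)

  -- Arcs between negative and non-negative vertices end in level 0, so an
  -- automorphism fixing level 0 pointwise may be cut off there.
  restrictToNegative : (g : Aut Γ) → (∀ v → level (g · v) ≡ level v) →
    PointwiseStabilizer Γ (Fibre φ 0ℤ) g → Aut Γ
  restrictToNegative g g-level g-fix =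
    mkAut (onNegative (Aut.to g)) (onNegative (Aut.from g))
      (onNegative-inverse (·-from g)
        (λ v → trans (sym (g-level (Aut.from g v))) (cong level (·-from g v))))
      (onNegative-inverse (from-· g) g-level)
      (onNegative-arc (Aut.to g) (·-arc g) g-fix)
      (onNegative-arc (Aut.from g) (from-arc g) (from-fixed g ∘ g-fix))

-- The case of a moved vertex below level 0.

nonempty : ∀ {A : Set a} {n} .{{_ : NonZero n}} → A ↔ Fin n → A
nonempty {n = suc _} enum = Inverse.from enum zero

0≤∣i∣+i : ∀ i → 0ℤ ℤ.≤ + ℤ.∣ i ∣ ℤ.+ i
0≤∣i∣+i (+ _)    = ℤ.+≤+ z≤n
0≤∣i∣+i -[1+ n ] = ℤ.≤-reflexive (sym (ℤ.+-inverseʳ (+ suc n)))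

negative-moved⇒highlyArcTransitive : (Γ : Digraph a ℓ) (φ : Hom Γ ℤ⃗) → ArcTransitive Γ →
  ∀ {q p} → HasInValency Γ q → HasOutValency Γ p → Prime q → Prime p →
  ∀ g → (∀ v → map φ (g · v) ≡ map φ v) → PointwiseStabilizer Γ (Fibre φ 0ℤ) g →
  ∀ {v} → g · v ≢ v → map φ v ℤ.< 0ℤ → HighlyArcTransitive Γ
negative-moved⇒highlyArcTransitive Γ φ arcTrans inVal outVal q-q-prime p-q-prime
  g g-level g-fix {v} gv≢v v<0 =
  -- At `v` the cut-off map `h` agrees with `g`, so `h` moves `v`.
  [ (λ fixed → contradiction (trans (sym (onNegative-neg (Aut.to g) v<0)) (fixed v ε)) gv≢v)
  , (λ (_ , moved) → highlyArcTransitive arcTrans inVal q-q-prime next {h} moved)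
  ]′ (first-moved inVal outVal next h (onNegative-nonneg (Aut.to g))
        -- The initial bound is the exact depth of `v`, as its level is negative.
        ℤ.∣ map φ v ∣ v (0≤∣i∣+i (map φ v)))
  where
  open Levels φ
  open Arcs Γ

  h : Aut Γ
  h = restrictToNegative g g-level g-fix

  next : ∀ v → ∃ (out-nbrs Γ v)
  next v = nonempty (outVal v)
    where instance _ = prime⇒nonZero p-q-prime

-- Reversal of arcs, and the theorem.

opp : Digraph a ℓ → Digraph a ℓ
opp Γ = record { V = V Γ ; E = λ u v → E Γ v u ; E-irrelevant = E-irrelevant Γ }

opp-Aut : {Γ : Digraph a ℓ} → Aut Γ → Aut (opp Γ)
opp-Aut g = record { bijection = Aut.bijection g ; arc⇔ = Aut.arc⇔ g }

-- Negation makes levels increase along the reversed arcs and leaves the fibre over 0 unchanged.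
opp-ℤ⃗ : {Γ : Digraph a ℓ} → Hom Γ ℤ⃗ → Hom (opp Γ) ℤ⃗
opp-ℤ⃗ φ = record
  { map     = -_ ∘ map φ
  ; map-arc = λ e → trans (neg-step (map φ _)) (cong (λ i → - i ℤ.+ 1ℤ) (sym (map-arc φ e)))
  }
  where
  neg-step : ∀ i → - i ≡ - (i ℤ.+ 1ℤ) ℤ.+ 1ℤ
  neg-step = solve-∀

opposite-inject₁ : ∀ {n} (i : Fin n) → opposite (inject₁ i) ≡ suc (opposite i)
opposite-inject₁ zero    = refl
opposite-inject₁ (suc i) = cong inject₁ (opposite-inject₁ i)

opp-KArc : {Γ : Digraph a ℓ} → ∀ {k} → KArc Γ k → KArc (opp Γ) k
opp-KArc {Γ = Γ} x = record
  { vertex = vertex x ∘ opposite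
  ; arc    = λ i → subst (λ j → E Γ (vertex x (inject₁ (opposite i))) (vertex x j))
                         (sym (opposite-inject₁ i)) (arc x (opposite i))
  }

opp-highlyArcTransitive : (Γ : Digraph a ℓ) → HighlyArcTransitive (opp Γ) → HighlyArcTransitive Γ
opp-highlyArcTransitive Γ hat k x y =
  let g , g-eq = hat k (opp-KArc x) (opp-KArc y)
  in opp-Aut g , λ i → subst (λ j → g · vertex x j ≡ vertex y j)
                             (Fin.opposite-involutive i) (g-eq (opposite i))

corollary5 : ∀ {a ℓ} (Γ : Digraph a ℓ) →
    Connected Γ → ArcTransitive Γ → PropertyZ Γ →
    (φ : Hom Γ ℤ⃗) → SurjectiveHom φ →
    (q p : ℕ) → HasInValency Γ q → HasOutValency Γ p → Prime q → Prime p →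
    NonTrivial (PointwiseStabilizer Γ (Fibre φ 0ℤ)) →
    HighlyArcTransitive Γ
corollary5 Γ connected arcTrans _ φ surjective q p inVal outVal q-q-prime p-q-prime
  (g , g-fix , v , gv≢v) = by-level (ℤ.<-cmp (map φ v) 0ℤ)
  where
  g-level : ∀ v → map φ (g · v) ≡ map φ v
  -- Surjectivity provides a vertex on level 0, which `g` fixes.
  g-level = let o , o-level = surjective 0ℤ in
    Levels.Aut-preserves-level φ connected g (g-fix (o-level refl))

  by-level : Tri (map φ v ℤ.< 0ℤ) (map φ v ≡ 0ℤ) (map φ v ℤ.> 0ℤ) → HighlyArcTransitive Γ
  by-level (tri< v<0 _ _) = negative-moved⇒highlyArcTransitive Γ φ arcTrans
    inVal outVal q-q-prime p-q-prime g g-level g-fix gv≢v v<0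
  by-level (tri≈ _ v≡0 _) = contradiction (g-fix v≡0) gv≢v
  -- Reversal puts `v` below level 0 and exchanges the two valencies, so primality of the
  -- out-valency is what drives this case.
  by-level (tri> _ _ v>0) = opp-highlyArcTransitive Γ
    (negative-moved⇒highlyArcTransitive (opp Γ) (opp-ℤ⃗ φ) opp-arcTrans
      outVal inVal p-q-prime q-q-prime (opp-Aut g) (λ v → cong -_ (g-level v))
      (g-fix ∘ ℤ.neg-injective) gv≢v (ℤ.neg-mono-< v>0))
    where
    opp-arcTrans : ArcTransitive (opp Γ)
    opp-arcTrans e e′ = let g , eq , eq′ = arcTrans e e′ in opp-Aut g , eq′ , eq
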